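{- Let $k,c$ be integers with $1<c<k$. Then $N(ck+c-k,k)=\gcd(c,k)$.
   Context: For $n>k\ge1$, $N(n,k)$ is the nullity of the $n\times n$ skew-symmetric Toeplitz matrix $A(n,k)$ whose first $k$ superdiagonals have all entries $1$ and whose remaining superdiagonals have all entries $0$. -}

module Defs where

open import Data.Bool using (if_then_else_; _∧_)
open import Data.Fin using (Fin; toℕ)
open import Data.Nat as ℕ using (ℕ; _<ᵇ_; _≤ᵇ_)
open import Data.Product using (Σ; ∃; _×_)
open import Data.Rational using (ℚ; 0ℚ; 1ℚ; -_; _*_)
open import Data.Rational.Properties using (+-0-monoid)
open import Data.Vec.Functional using (Vector)
open import Relation.Binary.PropositionalEquality using (_≡_; _≗_)
open import Algebra.Properties.Monoid.Sum +-0-monoid using (sum-syntax)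

-- The matrices below have integer entries, and nullity is unchanged under
-- field extension, so ℚ serves as the base field in place of ℝ or ℂ.
Matrix : ℕ → ℕ → Set
Matrix m n = Fin m → Fin n → ℚ

_·ᵛ_ : ∀ {m n} → Matrix m n → Vector ℚ n → Vector ℚ m
_·ᵛ_ {n = n} M v i = ∑[ j < n ] (M i j * v j)

linComb : ∀ {d n} → Vector ℚ d → Vector (Vector ℚ n) d → Vector ℚ n
linComb {d} a b j = ∑[ i < d ] (a i * b i j)

InKernel : ∀ {m n} → Matrix m n → Vector ℚ n → Set
InKernel M v = ∀ i → (M ·ᵛ v) i ≡ 0ℚ

LinearlyIndependent : ∀ {d n} → Vector (Vector ℚ n) d → Set
LinearlyIndependent {d} b =
  (a : Vector ℚ d) → (∀ j → linComb a b j ≡ 0ℚ) → ∀ i → a i ≡ 0ℚ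

record IsKernelBasis {m n d} (M : Matrix m n) (b : Vector (Vector ℚ n) d) : Set where
  field
    inKernel    : ∀ i → InKernel M (b i)
    independent : LinearlyIndependent b
    spanning    : ∀ v → InKernel M v → ∃ λ a → v ≗ linComb a b

-- Nullity is the dimension of the kernel. It is given as a relation between
-- a matrix and a number: `HasNullity M d` says that the kernel of M has a
-- basis with d elements. By invariance of dimension, d is determined by M.
HasNullity : ∀ {m n} → Matrix m n → ℕ → Set
HasNullity {n = n} M d = Σ (Vector (Vector ℚ n) d) (IsKernelBasis M)

-- Entry (i , j) is 1 if 1 ≤ j - i ≤ k, is -1 if 1 ≤ i - j ≤ k, and is 0
-- otherwise. Only the case n > k ≥ 1 is of interest.
A : (n k : ℕ) → Matrix n n
A n k i j =
  if (toℕ i <ᵇ toℕ j) ∧ (toℕ j ≤ᵇ toℕ i ℕ.+ k) then 1ℚ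
  else if (toℕ j <ᵇ toℕ i) ∧ (toℕ i ≤ᵇ toℕ j ℕ.+ k) then - 1ℚ
  else 0ℚ

-- `N[ n , k ]≡ d` expresses N(n,k) = d, where N(n,k) is the nullity of A(n,k).
N[_,_]≡_ : ℕ → ℕ → ℕ → Set
N[ n , k ]≡ d = HasNullity (A n k) d

{-# OPTIONS --safe #-}

-- Let F be the sequence of prefix sums of v ∈ ℚⁿ, delayed by k: it is 0 on
-- [0,k] and constant on [n+k,n+2k]. Row i of A(n,k) v = 0 says that
-- Q(m) = F(m+k+1) - F(m) satisfies Q(i+k) = Q(i). So v lies in the kernel iff
-- F climbs in steps of length k+1 by a k-periodic height h. Since
-- n + k = c(k+1), going up c steps from column i ∈ [0,k] reaches the height
-- F(i+n+k) = h(i) + h(i+1) + ... + h(i+c-1), and this is independent of i iff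
-- h is also c-periodic. Hence the kernel is isomorphic to the space of
-- gcd(c,k)-periodic sequences h.
module Submission where

open import Defs
open import Data.Nat using (ℕ; _+_; _*_; _∸_; _<_)
open import Data.Nat.GCD using (gcd)

open import Data.Bool using (true; false; if_then_else_; _∧_)
open import Data.Bool.Properties using (T-≡)
open import Data.Empty using (⊥-elim)
open import Data.Fin using (Fin; zero; suc; toℕ; fromℕ<)
open import Data.Fin.Properties using (toℕ<n; toℕ-fromℕ<; fromℕ<-cong; toℕ-injective)
open import Data.Nat using (zero; suc; _≤_; z≤n; s≤s; _<ᵇ_; _≤ᵇ_; NonZero; >-nonZero; ≢-nonZero; ≢-nonZero⁻¹; _/_; _%_; _≤?_)
open import Data.Nat.DivMod using (_mod_; m≡m%n+[m/n]*n; m%n<n; m<n⇒m%n≡m; m<n⇒m/n≡0; [m+n]%n≡m%n; n/n≡1; +-distrib-/-∣ʳ; m<n*o⇒m/o<n)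
open import Data.Nat.Divisibility using (_∣_; divides-refl; ∣-refl; ∣⇒≤)
open import Data.Nat.GCD using (gcd[m,n]∣m; gcd[m,n]∣n; gcd[m,n]≢0; gcd-GCD; module Bézout)
import Data.Nat.Properties as ℕₚ
open import Data.Product using (_,_)
open import Data.Rational as ℚ using (ℚ; 0ℚ; 1ℚ)
import Data.Rational.Properties as ℚₚ
open import Data.Rational.Solver using (module +-*-Solver)
open import Data.Sum using (inj₂)
open import Data.Vec.Functional using (Vector)
open import Function using (_∘_; Equivalence)
open import Relation.Binary.Definitions using (tri<; tri≈; tri>)
open import Relation.Binary.PropositionalEquality
open import Relation.Nullary using (yes; no; ¬_)
open import Algebra.Properties.CommutativeMonoid.Sum ℚₚ.+-0-commutativeMonoid using (sum; sum-cong-≗; ∑-distrib-+)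
open import Algebra.Properties.Group ℚₚ.+-0-group using () renaming (∙-cancelˡ to +-cancelˡ; ∙-cancelʳ to +-cancelʳ)

open ≡-Reasoning
open +-*-Solver using (solve; _:=_; _:+_; _:-_; con)

-- Periodic sequences

Periodic : ℕ → (ℕ → ℚ) → Set
Periodic p h = ∀ m → h (m + p) ≡ h m

module _ {h : ℕ → ℚ} where

  periodic-* : ∀ {p} → Periodic p h → ∀ q → Periodic (q * p) h
  periodic-* per zero m = cong h (ℕₚ.+-identityʳ m)
  periodic-* {p} per (suc q) m = begin
    h (m + (p + q * p)) ≡⟨ cong h (sym (ℕₚ.+-assoc m p (q * p))) ⟩
    h (m + p + q * p)   ≡⟨ periodic-* per q (m + p) ⟩
    h (m + p)           ≡⟨ per m ⟩
    h m                 ∎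

  periodic-∣ : ∀ {p q} → p ∣ q → Periodic p h → Periodic q h
  periodic-∣ (divides-refl q) per = periodic-* per q

  periodic-% : ∀ {p} .{{_ : NonZero p}} → Periodic p h → ∀ m → h (m % p) ≡ h m
  periodic-% {p} per m = begin
    h (m % p)               ≡⟨ periodic-* per (m / p) (m % p) ⟨
    h (m % p + (m / p) * p) ≡⟨ cong h (m≡m%n+[m/n]*n m p) ⟨
    h m                     ∎

  private
    periodic-difference : ∀ {d a b} → d + b ≡ a → Periodic a h → Periodic b h → Periodic d h
    periodic-difference {d} {a} {b} eq pa pb m = begin
      h (m + d)       ≡⟨ pb (m + d) ⟨
      h (m + d + b)   ≡⟨ cong h (trans (ℕₚ.+-assoc m d b) (cong (m +_) eq)) ⟩
      h (m + a)       ≡⟨ pa m ⟩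
      h m             ∎

  -- Bézout over ℕ exhibits the gcd as a difference of a multiple of one period and a multiple of
  -- the other, so one multiple is stepped forward and the other is undone.
  periodic-gcd : ∀ {p q} → Periodic p h → Periodic q h → Periodic (gcd p q) h
  periodic-gcd {p} {q} pp pq with Bézout.identity (gcd-GCD p q)
  ... | Bézout.+- x y eq = periodic-difference eq (periodic-* pp x) (periodic-* pq y)
  ... | Bézout.-+ x y eq = periodic-difference eq (periodic-* pq y) (periodic-* pp x)

cycle : ∀ {d} .{{_ : NonZero d}} → Vector ℚ d → ℕ → ℚ
cycle {d} a m = a (m mod d)

cycle-periodic : ∀ {d} .{{_ : NonZero d}} (a : Vector ℚ d) → Periodic d (cycle a)
cycle-periodic {d} a m = cong a (fromℕ<-cong _ _ ([m+n]%n≡m%n m d) _ _)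

cycle-toℕ : ∀ {d} .{{_ : NonZero d}} (a : Vector ℚ d) i → cycle a (toℕ i) ≡ a i
cycle-toℕ a i = cong a (toℕ-injective (trans (toℕ-fromℕ< _) (m<n⇒m%n≡m (toℕ<n i))))

-- Prefix sums and the rows of A n k

-- Positions range over all of ℕ; past the length of the vector the sum saturates, which makes the
-- upper end constant.
prefix : ∀ {n} → Vector ℚ n → ℕ → ℚ
prefix {zero}  v m       = 0ℚ
prefix {suc n} v zero    = 0ℚ
prefix {suc n} v (suc m) = v zero ℚ.+ prefix (v ∘ suc) m

prefix-zero : ∀ {n} (v : Vector ℚ n) → prefix v 0 ≡ 0ℚ
prefix-zero {zero}  v = refl
prefix-zero {suc n} v = refl

prefix-suc : ∀ {n} (v : Vector ℚ n) j → prefix v (suc (toℕ j)) ≡ prefix v (toℕ j) ℚ.+ v j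
prefix-suc {suc n} v zero = begin
  v zero ℚ.+ prefix (v ∘ suc) 0 ≡⟨ cong (v zero ℚ.+_) (prefix-zero (v ∘ suc)) ⟩
  v zero ℚ.+ 0ℚ                 ≡⟨ ℚₚ.+-comm (v zero) 0ℚ ⟩
  0ℚ ℚ.+ v zero                 ∎
prefix-suc v (suc j) =
  trans (cong (v zero ℚ.+_) (prefix-suc (v ∘ suc) j)) (sym (ℚₚ.+-assoc (v zero) _ _))

prefix-full : ∀ {n} (v : Vector ℚ n) {m} → n ≤ m → prefix v m ≡ prefix v n
prefix-full {zero}  v n≤m       = refl
prefix-full {suc n} v (s≤s n≤m) = cong (v zero ℚ.+_) (prefix-full (v ∘ suc) n≤m)

prefix-differences : ∀ n (G : ℕ → ℚ) {m} → m ≤ n →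
  prefix {n} (λ j → G (suc (toℕ j)) ℚ.- G (toℕ j)) m ≡ G m ℚ.- G 0
prefix-differences zero    G z≤n = sym (ℚₚ.+-inverseʳ (G 0))
prefix-differences (suc n) G z≤n = sym (ℚₚ.+-inverseʳ (G 0))
prefix-differences (suc n) G {suc m} (s≤s m≤n) = trans
  (cong (G 1 ℚ.- G 0 ℚ.+_) (prefix-differences n (G ∘ suc) m≤n))
  (solve 3 (λ x y z → (y :- x) :+ (z :- y) := z :- x) refl (G 0) (G 1) (G (suc m)))

χ : ℕ → ℕ → ℚ
χ j m = if j <ᵇ m then 1ℚ else 0ℚ

sum-χ : ∀ {n} (v : Vector ℚ n) m → sum (λ j → χ (toℕ j) m ℚ.* v j) ≡ prefix v m
sum-χ {zero}  v m       = refl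
sum-χ {suc n} v zero    = cong₂ ℚ._+_ (ℚₚ.*-zeroˡ (v zero))
  (trans (sum-χ (v ∘ suc) 0) (prefix-zero (v ∘ suc)))
sum-χ {suc n} v (suc m) = cong₂ ℚ._+_ (ℚₚ.*-identityˡ (v zero)) (sum-χ (v ∘ suc) m)

<ᵇ-true : ∀ {m n} → m < n → (m <ᵇ n) ≡ true
<ᵇ-true m<n = Equivalence.to T-≡ (ℕₚ.<⇒<ᵇ m<n)

<ᵇ-false : ∀ {m n} → n ≤ m → (m <ᵇ n) ≡ false
<ᵇ-false {m} {n} n≤m with m <ᵇ n in eq
... | false = refl
... | true  = ⊥-elim (ℕₚ.<⇒≱ (ℕₚ.<ᵇ⇒< m n (Equivalence.from T-≡ eq)) n≤m)

≤ᵇ≡<ᵇ-suc : ∀ m n → (m ≤ᵇ n) ≡ (m <ᵇ suc n)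
≤ᵇ≡<ᵇ-suc zero    n = refl
≤ᵇ≡<ᵇ-suc (suc m) n = refl

-- Row `i` is the indicator of (i, i+k] minus that of [i-k, i), and each interval is a difference of
-- two initial segments. The negative terms are moved across the equation. At the left border
-- `i ∸ k` truncates to 0, the empty segment.
entry-χ : ∀ k i j →
  (if (i <ᵇ j) ∧ (j ≤ᵇ i + k) then 1ℚ
   else if (j <ᵇ i) ∧ (i ≤ᵇ j + k) then ℚ.- 1ℚ
   else 0ℚ) ℚ.+ (χ j (suc i) ℚ.+ χ j i)
  ≡ χ j (suc (i + k)) ℚ.+ χ j (i ∸ k)
entry-χ k i j rewrite ≤ᵇ≡<ᵇ-suc j (i + k) | ≤ᵇ≡<ᵇ-suc i (j + k) with ℕₚ.<-cmp i j
... | tri< i<j _ _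
  rewrite <ᵇ-true i<j | <ᵇ-false (ℕₚ.<⇒≤ i<j) | <ᵇ-false i<j
        | <ᵇ-false (ℕₚ.≤-trans (ℕₚ.m∸n≤m i k) (ℕₚ.<⇒≤ i<j))
  with j <ᵇ suc (i + k)
... | true  = refl
... | false = refl
entry-χ k i j | tri≈ _ refl _
  rewrite <ᵇ-false (ℕₚ.≤-refl {i}) | <ᵇ-true (ℕₚ.n<1+n i)
        | <ᵇ-true (s≤s (ℕₚ.m≤m+n i k)) | <ᵇ-false (ℕₚ.m∸n≤m i k) = refl
entry-χ k i j | tri> _ _ j<i
  rewrite <ᵇ-false (ℕₚ.<⇒≤ j<i) | <ᵇ-true j<i
        | <ᵇ-true (ℕₚ.m<n⇒m<1+n j<i)
        | <ᵇ-true (ℕₚ.m<n⇒m<1+n (ℕₚ.<-≤-trans j<i (ℕₚ.m≤m+n i k)))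
  with i ≤? j + k
... | yes i≤j+k
  rewrite <ᵇ-true (s≤s i≤j+k)
        | <ᵇ-false (ℕₚ.m≤n+o⇒m∸n≤o i k (subst (i ≤_) (ℕₚ.+-comm j k) i≤j+k)) = refl
... | no i≰j+k
  rewrite <ᵇ-false (ℕₚ.≰⇒> i≰j+k)
        | <ᵇ-true (ℕₚ.m+n≤o⇒m≤o∸n (suc j) (ℕₚ.≰⇒> i≰j+k)) = refl

sum-distribʳ : ∀ {n} (f g v : Vector ℚ n) →
  sum (λ j → (f j ℚ.+ g j) ℚ.* v j) ≡ sum (λ j → f j ℚ.* v j) ℚ.+ sum (λ j → g j ℚ.* v j)
sum-distribʳ f g v = trans
  (sum-cong-≗ (λ j → ℚₚ.*-distribʳ-+ (v j) (f j) (g j)))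
  (∑-distrib-+ (λ j → f j ℚ.* v j) (λ j → g j ℚ.* v j))

A-row : ∀ {n} k (v : Vector ℚ n) i →
  (A n k ·ᵛ v) i ℚ.+ (prefix v (suc (toℕ i)) ℚ.+ prefix v (toℕ i))
  ≡ prefix v (suc (toℕ i + k)) ℚ.+ prefix v (toℕ i ∸ k)
A-row {n} k v i = begin
  (A n k ·ᵛ v) i ℚ.+ (prefix v (suc x) ℚ.+ prefix v x)
    ≡⟨ cong ((A n k ·ᵛ v) i ℚ.+_) (cong₂ ℚ._+_ (sum-χ v (suc x)) (sum-χ v x)) ⟨
  (A n k ·ᵛ v) i ℚ.+ (sum (λ j → X (suc x) j ℚ.* v j) ℚ.+ sum (λ j → X x j ℚ.* v j))
    ≡⟨ cong ((A n k ·ᵛ v) i ℚ.+_) (sum-distribʳ (X (suc x)) (X x) v) ⟨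
  (A n k ·ᵛ v) i ℚ.+ sum (λ j → (X (suc x) j ℚ.+ X x j) ℚ.* v j)
    ≡⟨ sum-distribʳ (A n k i) (λ j → X (suc x) j ℚ.+ X x j) v ⟨
  sum (λ j → (A n k i j ℚ.+ (X (suc x) j ℚ.+ X x j)) ℚ.* v j)
    ≡⟨ sum-cong-≗ (λ j → cong (ℚ._* v j) (entry-χ k x (toℕ j))) ⟩
  sum (λ j → (X (suc (x + k)) j ℚ.+ X (x ∸ k) j) ℚ.* v j)
    ≡⟨ sum-distribʳ (X (suc (x + k))) (X (x ∸ k)) v ⟩
  sum (λ j → X (suc (x + k)) j ℚ.* v j) ℚ.+ sum (λ j → X (x ∸ k) j ℚ.* v j)
    ≡⟨ cong₂ ℚ._+_ (sum-χ v (suc (x + k))) (sum-χ v (x ∸ k)) ⟩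
  prefix v (suc (x + k)) ℚ.+ prefix v (x ∸ k) ∎
  where
  x = toℕ i
  X : ℕ → Vector ℚ n
  X m j = χ (toℕ j) m

-- Truncation of m ∸ k is harmless: prefix sums vanish at negative positions.
delayed : ∀ {n} → ℕ → Vector ℚ n → ℕ → ℚ
delayed k v m = prefix v (m ∸ k)

delayed-low : ∀ {n} k (v : Vector ℚ n) {m} → m ≤ k → delayed k v m ≡ 0ℚ
delayed-low k v m≤k = trans (cong (prefix v) (ℕₚ.m≤n⇒m∸n≡0 m≤k)) (prefix-zero v)

delayed-high : ∀ {n} k (v : Vector ℚ n) {m} → n + k ≤ m → delayed k v m ≡ prefix v n
delayed-high {n} k v n+k≤m = prefix-full v (ℕₚ.m+n≤o⇒m≤o∸n n n+k≤m)

delayed-+ : ∀ {n} k (v : Vector ℚ n) m → delayed k v (m + k) ≡ prefix v m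
delayed-+ k v m = cong (prefix v) (ℕₚ.m+n∸n≡m m k)

module _ {n : ℕ} (k : ℕ) (v : Vector ℚ n) where
  private F = delayed k v

  -- Regrouped with Q(m) = F(m+k+1) - F(m), this says that entry x of the product is Q(x+k) - Q(x).
  -- The delay by `k` is what gives both differences the same shape.
  A-row-delayed : ∀ i → let x = toℕ i in
    (A n k ·ᵛ v) i ℚ.+ (F (x + suc k) ℚ.+ F (x + k)) ≡ F (x + k + suc k) ℚ.+ F x
  A-row-delayed i = begin
    (A n k ·ᵛ v) i ℚ.+ (F (x + suc k) ℚ.+ F (x + k))
      ≡⟨ cong ((A n k ·ᵛ v) i ℚ.+_) (cong₂ ℚ._+_ (F-+suc x) (delayed-+ k v x)) ⟩
    (A n k ·ᵛ v) i ℚ.+ (prefix v (suc x) ℚ.+ prefix v x)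
      ≡⟨ A-row k v i ⟩
    prefix v (suc (x + k)) ℚ.+ prefix v (x ∸ k)
      ≡⟨ cong (ℚ._+ F x) (F-+suc (x + k)) ⟨
    F (x + k + suc k) ℚ.+ F x ∎
    where
    x = toℕ i
    F-+suc : ∀ m → F (m + suc k) ≡ prefix v (suc m)
    F-+suc m = trans (cong F (ℕₚ.+-suc m k)) (delayed-+ k v (suc m))

-- Staircases

-- Positions are laid out in rows of length `suc k`: column i of row q is i + q(k+1). Row 0 vanishes
-- and `h` gives the climbs out of rows 0 to c-1, so `F` is determined on rows 0 to c.
record IsStaircase (k c : ℕ) (F h : ℕ → ℚ) : Set where
  field
    low  : ∀ {i} → i ≤ k → F i ≡ 0ℚ
    step : ∀ {m} → m < c * suc k → F (m + suc k) ≡ F m ℚ.+ h m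

  step-row : ∀ {q i} → q < c → i ≤ k →
    F (i + suc q * suc k) ≡ F (i + q * suc k) ℚ.+ h (i + q * suc k)
  step-row {q} {i} q<c i≤k = trans (cong F eq) (step below)
    where
    eq : i + suc q * suc k ≡ i + q * suc k + suc k
    eq = trans (cong (i +_) (ℕₚ.+-comm (suc k) (q * suc k))) (sym (ℕₚ.+-assoc i _ _))
    below : i + q * suc k < c * suc k
    below = ℕₚ.<-≤-trans (ℕₚ.+-monoˡ-< (q * suc k) (s≤s i≤k)) (ℕₚ.*-monoˡ-≤ (suc k) q<c)

module _ {k c : ℕ} {F h : ℕ → ℚ} (stairs : IsStaircase k c F h) where
  open IsStaircase stairs

  -- Column i of row q is h i + h (i + 1) + ... + h (i + q - 1), because suc k
  -- acts as 1 on sequences of period k.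
  staircase-shift : Periodic k h → ∀ {i} → i < k → ∀ {q} → q ≤ c →
    F (suc i + q * suc k) ℚ.+ h i ≡ F (i + q * suc k) ℚ.+ h (i + q)
  staircase-shift per {i} i<k {zero} q≤c
    rewrite ℕₚ.+-identityʳ i = cong (ℚ._+ h i) (trans (low i<k) (sym (low (ℕₚ.<⇒≤ i<k))))
  staircase-shift per {i} i<k {suc q} q<c = begin
    F (suc i + suc q * suc k) ℚ.+ h i
      ≡⟨ cong (ℚ._+ h i) (trans (step-row q<c i<k) (cong (F (suc i + q * suc k) ℚ.+_) (per-row (suc i)))) ⟩
    F (suc i + q * suc k) ℚ.+ h (suc i + q) ℚ.+ h i
      ≡⟨ solve 3 (λ x y z → x :+ y :+ z := x :+ z :+ y) refl (F (suc i + q * suc k)) (h (suc i + q)) (h i) ⟩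
    F (suc i + q * suc k) ℚ.+ h i ℚ.+ h (suc i + q)
      ≡⟨ cong₂ ℚ._+_ (staircase-shift per i<k (ℕₚ.<⇒≤ q<c)) (cong h (sym (ℕₚ.+-suc i q))) ⟩
    F (i + q * suc k) ℚ.+ h (i + q) ℚ.+ h (i + suc q)
      ≡⟨ cong (ℚ._+ h (i + suc q)) (trans (step-row q<c (ℕₚ.<⇒≤ i<k)) (cong (F (i + q * suc k) ℚ.+_) (per-row i))) ⟨
    F (i + suc q * suc k) ℚ.+ h (i + suc q) ∎
    where
    per-row : ∀ i → h (i + q * suc k) ≡ h (i + q)
    per-row i = begin
      h (i + q * suc k)   ≡⟨ cong (λ x → h (i + x)) (ℕₚ.*-suc q k) ⟩
      h (i + (q + q * k)) ≡⟨ cong h (ℕₚ.+-assoc i q (q * k)) ⟨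
      h (i + q + q * k)   ≡⟨ periodic-* per q (i + q) ⟩
      h (i + q)           ∎

  -- In row `c` the shift identity compares adjacent columns with the error h(i+c) - h(i), which
  -- `c`-periodicity removes.
  staircase-constant : Periodic k h → Periodic c h → ∀ {i} → i ≤ k →
    F (i + c * suc k) ≡ F (c * suc k)
  staircase-constant pk pc {zero}  i≤k = refl
  staircase-constant pk pc {suc i} i<k = trans
    (+-cancelʳ (h i) _ _
      (trans (staircase-shift pk i<k ℕₚ.≤-refl) (cong (F (i + c * suc k) ℚ.+_) (pc i))))
    (staircase-constant pk pc (ℕₚ.<⇒≤ i<k))

  staircase-unique : ∀ {F′ h′} → IsStaircase k c F′ h′ → (∀ m → h m ≡ h′ m) →
    ∀ {m} → m < suc c * suc k → F m ≡ F′ m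
  staircase-unique {F′} {h′} stairs′ h≗h′ {m} m<N =
    subst (λ x → F x ≡ F′ x) (sym (m≡m%n+[m/n]*n m (suc k)))
      (rows (m / suc k) (ℕₚ.≤-pred (m<n*o⇒m/o<n m<N)))
    where
    i = m % suc k
    i≤k : i ≤ k
    i≤k = ℕₚ.≤-pred (m%n<n m (suc k))
    rows : ∀ q → q ≤ c → F (i + q * suc k) ≡ F′ (i + q * suc k)
    rows zero q≤c = subst (λ x → F x ≡ F′ x) (sym (ℕₚ.+-identityʳ i))
      (trans (low i≤k) (sym (IsStaircase.low stairs′ i≤k)))
    rows (suc q) q<c = begin
      F (i + suc q * suc k)
        ≡⟨ step-row q<c i≤k ⟩
      F (i + q * suc k) ℚ.+ h (i + q * suc k)
        ≡⟨ cong₂ ℚ._+_ (rows q (ℕₚ.<⇒≤ q<c)) (h≗h′ (i + q * suc k)) ⟩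
      F′ (i + q * suc k) ℚ.+ h′ (i + q * suc k)
        ≡⟨ IsStaircase.step-row stairs′ q<c i≤k ⟨
      F′ (i + suc q * suc k) ∎

-- The sum h(i) + h(i+p) + ... + h(i+(q-1)p): the height of column `i` in row `q` when rows have
-- length `p`.
climb : ℕ → (ℕ → ℚ) → ℕ → ℕ → ℚ
climb p h zero    i = 0ℚ
climb p h (suc q) i = climb p h q i ℚ.+ h (i + q * p)

staircase : ℕ → (ℕ → ℚ) → ℕ → ℚ
staircase k h m = climb (suc k) h (m / suc k) (m % suc k)

staircase-isStaircase : ∀ k c h → IsStaircase k c (staircase k h) h
staircase-isStaircase k c h = record { low = low ; step = λ {m} _ → step m }
  where
  low : ∀ {i} → i ≤ k → staircase k h i ≡ 0ℚ
  low {i} i≤k = cong (λ q → climb (suc k) h q (i % suc k)) (m<n⇒m/n≡0 (s≤s i≤k))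
  quot : ∀ m → (m + suc k) / suc k ≡ suc (m / suc k)
  quot m = begin
    (m + suc k) / suc k           ≡⟨ +-distrib-/-∣ʳ m ∣-refl ⟩
    m / suc k + suc k / suc k     ≡⟨ cong (m / suc k +_) (n/n≡1 (suc k)) ⟩
    m / suc k + 1                 ≡⟨ ℕₚ.+-comm (m / suc k) 1 ⟩
    suc (m / suc k)               ∎
  step : ∀ m → staircase k h (m + suc k) ≡ staircase k h m ℚ.+ h m
  step m = begin
    climb (suc k) h ((m + suc k) / suc k) ((m + suc k) % suc k)
      ≡⟨ cong₂ (climb (suc k) h) (quot m) ([m+n]%n≡m%n m (suc k)) ⟩
    staircase k h m ℚ.+ h (m % suc k + (m / suc k) * suc k)
      ≡⟨ cong (λ x → staircase k h m ℚ.+ h x) (m≡m%n+[m/n]*n m (suc k)) ⟨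
    staircase k h m ℚ.+ h m ∎

-- Linearity in the step heights

unit : ∀ {d} → Fin d → Vector ℚ d
unit zero    zero    = 1ℚ
unit zero    (suc j) = 0ℚ
unit (suc i) zero    = 0ℚ
unit (suc i) (suc j) = unit i j

sum-zero : ∀ {d} (a : Vector ℚ d) → sum (λ r → a r ℚ.* 0ℚ) ≡ 0ℚ
sum-zero {zero}  a = refl
sum-zero {suc d} a = cong₂ ℚ._+_ (ℚₚ.*-zeroʳ (a zero)) (sum-zero (a ∘ suc))

sum-unit : ∀ {d} (a : Vector ℚ d) j → sum (λ r → a r ℚ.* unit r j) ≡ a j
sum-unit {suc d} a zero = trans
  (cong₂ ℚ._+_ (ℚₚ.*-identityʳ (a zero)) (sum-zero (a ∘ suc))) (ℚₚ.+-identityʳ (a zero))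
sum-unit {suc d} a (suc j) = trans
  (cong₂ ℚ._+_ (ℚₚ.*-zeroʳ (a zero)) (sum-unit (a ∘ suc) j)) (ℚₚ.+-identityˡ (a (suc j)))

sum-distribˡ : ∀ {d} (a f g : Vector ℚ d) →
  sum (λ r → a r ℚ.* (f r ℚ.+ g r)) ≡ sum (λ r → a r ℚ.* f r) ℚ.+ sum (λ r → a r ℚ.* g r)
sum-distribˡ a f g = trans
  (sum-cong-≗ (λ r → ℚₚ.*-distribˡ-+ (a r) (f r) (g r)))
  (∑-distrib-+ (λ r → a r ℚ.* f r) (λ r → a r ℚ.* g r))

module _ {d : ℕ} .{{_ : NonZero d}} (a : Vector ℚ d) where

  -- Each single height of `cycle a` is one coordinate of `a`, and summing against unit vectors
  -- picks out that coordinate.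
  climb-linear : ∀ p q i →
    sum (λ r → a r ℚ.* climb p (cycle (unit r)) q i) ≡ climb p (cycle a) q i
  climb-linear p zero    i = sum-zero a
  climb-linear p (suc q) i = trans
    (sum-distribˡ a (λ r → climb p (cycle (unit r)) q i) (λ r → cycle (unit r) (i + q * p)))
    (cong₂ ℚ._+_ (climb-linear p q i) (sum-unit a ((i + q * p) mod d)))

-- Differencing the staircase, shifted by `k`, inverts the passage from a vector to its delayed
-- prefix sums.
kernelVector : ∀ {d} .{{_ : NonZero d}} n → ℕ → Vector ℚ d → Vector ℚ n
kernelVector n k a j = F (suc (toℕ j) + k) ℚ.- F (toℕ j + k)
  where F = staircase k (cycle a)

kernelVector-linear : ∀ {d} .{{_ : NonZero d}} n k (a : Vector ℚ d) j →
  linComb a (λ r → kernelVector n k (unit r)) j ≡ kernelVector n k a j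
kernelVector-linear {d} n k a j = begin
  -- Additivity of the sum suffices for a difference: the second sum is added, absorbed termwise,
  -- and subtracted again.
  Σ (λ r → S r x ℚ.- S r y)
    ≡⟨ solve 2 (λ s t → s := s :+ t :- t) refl (Σ (λ r → S r x ℚ.- S r y)) (Σ (λ r → S r y)) ⟩
  Σ (λ r → S r x ℚ.- S r y) ℚ.+ Σ (λ r → S r y) ℚ.- Σ (λ r → S r y)
    ≡⟨ cong (ℚ._- Σ (λ r → S r y)) (sum-distribˡ a (λ r → S r x ℚ.- S r y) (λ r → S r y)) ⟨
  Σ (λ r → S r x ℚ.- S r y ℚ.+ S r y) ℚ.- Σ (λ r → S r y)
    ≡⟨ cong (ℚ._- Σ (λ r → S r y)) (sum-cong-≗ (λ r → cong (a r ℚ.*_)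
         (solve 2 (λ s t → s :- t :+ t := s) refl (S r x) (S r y)))) ⟩
  Σ (λ r → S r x) ℚ.- Σ (λ r → S r y)
    ≡⟨ cong₂ ℚ._-_ (linear x) (linear y) ⟩
  staircase k (cycle a) x ℚ.- staircase k (cycle a) y ∎
  where
  x = suc (toℕ j) + k
  y = toℕ j + k
  S : Fin d → ℕ → ℚ
  S r = staircase k (cycle (unit r))
  Σ : Vector ℚ d → ℚ
  Σ f = sum (λ r → a r ℚ.* f r)
  linear : ∀ m → Σ (λ r → S r m) ≡ staircase k (cycle a) m
  linear m = climb-linear a (suc k) (m / suc k) (m % suc k)

-- Descending by `k` from any position below n + k lands below `n`, where the periodicity is
-- available.
partially-periodic-% : ∀ (n k : ℕ) .{{_ : NonZero k}} (Q : ℕ → ℚ) →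
  (∀ {i} → i < n → Q (i + k) ≡ Q i) → ∀ {m} → m < n + k → Q m ≡ Q (m % k)
partially-periodic-% n k Q per {m} m<n+k = trans (cong Q (m≡m%n+[m/n]*n m k))
  (go (m / k) (subst (_< n + k) (m≡m%n+[m/n]*n m k) m<n+k))
  where
  i = m % k
  go : ∀ q → i + q * k < n + k → Q (i + q * k) ≡ Q i
  go zero    _  = cong Q (ℕₚ.+-identityʳ i)
  go (suc q) lt = trans (cong Q eq) (trans (per below) (go q (ℕₚ.m≤n⇒m≤n+o k below)))
    where
    eq : i + suc q * k ≡ i + q * k + k
    eq = trans (cong (i +_) (ℕₚ.+-comm k (q * k))) (sym (ℕₚ.+-assoc i _ _))
    below : i + q * k < n
    below = ℕₚ.+-cancelʳ-< k (i + q * k) n (subst (_< n + k) eq lt)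

-- The kernel of `A n k` when n + k = c(k+1)

module _ (n k c : ℕ) .{{_ : NonZero k}} .{{_ : NonZero c}} (size : n + k ≡ c * suc k) where

  private
    d = gcd c k

    k≢0 : ¬ k ≡ 0
    k≢0 = ≢-nonZero⁻¹ k

    instance
      d≢0 : NonZero d
      d≢0 = ≢-nonZero (gcd[m,n]≢0 c k (inj₂ k≢0))

    -- Since n + 2k = c(k+1) + k, this is the last position of row `c`.
    <-range : ∀ {m} → m ≤ n + k + k → m < suc c * suc k
    <-range m≤ = s≤s (ℕₚ.≤-trans m≤ (ℕₚ.≤-reflexive (trans (cong (_+ k) size) (ℕₚ.+-comm _ k))))

    high : ∀ i → n + k ≤ i + c * suc k
    high i = subst (_≤ i + c * suc k) (sym size) (ℕₚ.m≤n+m _ i)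

  -- From periodic heights to kernel vectors

  module _ (a : Vector ℚ d) where
    private
      h = cycle a
      F = staircase k h
      v = kernelVector n k a
      stairs = staircase-isStaircase k c h
      open IsStaircase stairs

      k-periodic : Periodic k h
      k-periodic = periodic-∣ (gcd[m,n]∣n c k) (cycle-periodic a)

      c-periodic : Periodic c h
      c-periodic = periodic-∣ (gcd[m,n]∣m c k) (cycle-periodic a)

      prefix-v : ∀ {m} → m ≤ n → prefix v m ≡ F (m + k)
      prefix-v {m} m≤n = begin
        prefix v m            ≡⟨ prefix-differences n (λ x → F (x + k)) m≤n ⟩
        F (m + k) ℚ.- F k     ≡⟨ cong (λ y → F (m + k) ℚ.- y) (low ℕₚ.≤-refl) ⟩
        F (m + k) ℚ.- 0ℚ      ≡⟨ ℚₚ.+-identityʳ (F (m + k)) ⟩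
        F (m + k)             ∎

    -- Both sides vanish on [0,k] and agree up to n + k by telescoping. The bound n + 2k covers
    -- every position that occurs in a row condition.
    delayed-kernelVector : ∀ {m} → m ≤ n + k + k → delayed k v m ≡ F m
    delayed-kernelVector {m} m≤ with m ≤? k | m ≤? n + k
    ... | yes m≤k | _ = trans (delayed-low k v m≤k) (sym (low m≤k))
    ... | no m≰k | yes m≤n+k = trans
      (prefix-v (ℕₚ.m≤n+o⇒m∸n≤o m k (subst (m ≤_) (ℕₚ.+-comm n k) m≤n+k)))
      (cong F (ℕₚ.m∸n+n≡m (ℕₚ.<⇒≤ (ℕₚ.≰⇒> m≰k))))
    -- The prefix sum is saturated here, so the staircase must be constant along row `c`; this is
    -- where `c`-periodicity of the heights enters.
    ... | no _ | no m≰n+k = begin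
      delayed k v m             ≡⟨ delayed-high k v n+k≤m ⟩
      prefix v n                ≡⟨ prefix-v ℕₚ.≤-refl ⟩
      F (n + k)                 ≡⟨ cong F size ⟩
      F (c * suc k)             ≡⟨ staircase-constant stairs k-periodic c-periodic i≤k ⟨
      F (i + c * suc k)         ≡⟨ cong (λ x → F (i + x)) size ⟨
      F (i + (n + k))           ≡⟨ cong F (ℕₚ.m∸n+n≡m n+k≤m) ⟩
      F m                       ∎
      where
      n+k≤m = ℕₚ.<⇒≤ (ℕₚ.≰⇒> m≰n+k)
      i = m ∸ (n + k)
      i≤k : i ≤ k
      i≤k = ℕₚ.m≤n+o⇒m∸n≤o m (n + k) m≤

    -- The climbs from x and from x + k are `h x` and `h (x + k)`, equal by `k`-periodicity, which
    -- is the row condition.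
    kernelVector-inKernel : InKernel (A n k) v
    kernelVector-inKernel i = +-cancelʳ s _ _ (begin
      (A n k ·ᵛ v) i ℚ.+ s
        ≡⟨ A-row-delayed k v i ⟩
      D (x + k + suc k) ℚ.+ D x
        ≡⟨ cong₂ ℚ._+_ (delayed-kernelVector top) (delayed-kernelVector (≤-lift (ℕₚ.m≤m+n x (k + suc k)))) ⟩
      F (x + k + suc k) ℚ.+ F x
        ≡⟨ cong (ℚ._+ F x) (step (ℕₚ.<-≤-trans (ℕₚ.+-monoˡ-< k x<n) (ℕₚ.≤-reflexive size))) ⟩
      F (x + k) ℚ.+ h (x + k) ℚ.+ F x
        ≡⟨ cong (λ y → F (x + k) ℚ.+ y ℚ.+ F x) (k-periodic x) ⟩
      F (x + k) ℚ.+ h x ℚ.+ F x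
        ≡⟨ solve 3 (λ p q r → p :+ q :+ r := con 0ℚ :+ (r :+ q :+ p)) refl (F (x + k)) (h x) (F x) ⟩
      0ℚ ℚ.+ (F x ℚ.+ h x ℚ.+ F (x + k))
        ≡⟨ cong (λ y → 0ℚ ℚ.+ (y ℚ.+ F (x + k))) (step (ℕₚ.<-≤-trans (ℕₚ.m≤n⇒m≤n+o k x<n) (ℕₚ.≤-reflexive size))) ⟨
      0ℚ ℚ.+ (F (x + suc k) ℚ.+ F (x + k))
        ≡⟨ cong (0ℚ ℚ.+_) (cong₂ ℚ._+_
             (delayed-kernelVector (≤-lift (ℕₚ.+-monoʳ-≤ x (ℕₚ.m≤n+m (suc k) k))))
             (delayed-kernelVector (≤-lift (ℕₚ.+-monoʳ-≤ x (ℕₚ.m≤m+n k (suc k)))))) ⟨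
      0ℚ ℚ.+ s ∎)
      where
      x = toℕ i
      x<n = toℕ<n i
      D = delayed k v
      s = D (x + suc k) ℚ.+ D (x + k)
      top : x + k + suc k ≤ n + k + k
      top = subst (_≤ n + k + k) (sym (ℕₚ.+-suc (x + k) k)) (ℕₚ.+-monoˡ-≤ k (ℕₚ.+-monoˡ-≤ k x<n))
      ≤-lift : ∀ {m} → m ≤ x + (k + suc k) → m ≤ n + k + k
      ≤-lift m≤ = ℕₚ.≤-trans m≤ (subst (_≤ n + k + k) (ℕₚ.+-assoc x k (suc k)) top)

    -- Coordinate `a r` is the first climb in column `r`, from height 0 in row 0, and so is itself a
    -- prefix sum of the vector.
    kernelVector-injective : (∀ j → v j ≡ 0ℚ) → ∀ r → a r ≡ 0ℚ
    kernelVector-injective v≡0 r = begin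
      a r                    ≡⟨ cycle-toℕ a r ⟨
      h x                    ≡⟨ ℚₚ.+-identityˡ (h x) ⟨
      0ℚ ℚ.+ h x             ≡⟨ cong (ℚ._+ h x) (low x≤k) ⟨
      F x ℚ.+ h x            ≡⟨ step (ℕₚ.<-≤-trans (ℕₚ.m≤n⇒m≤n+o k x<n) (ℕₚ.≤-reflexive size)) ⟨
      F (x + suc k)          ≡⟨ cong F (ℕₚ.+-suc x k) ⟩
      F (suc x + k)          ≡⟨ prefix-v x<n ⟨
      prefix v (suc x)       ≡⟨ prefix-≡0 v v≡0 (suc x) ⟩
      0ℚ                     ∎
      where
      x = toℕ r
      x≤k : x ≤ k
      x≤k = ℕₚ.≤-trans (ℕₚ.<⇒≤ (toℕ<n r)) (∣⇒≤ (gcd[m,n]∣n c k))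
      -- Here r < gcd(c,k) ≤ c ≤ n, the last because n + k = c + ck ≥ c + k.
      x<n : x < n
      x<n = ℕₚ.<-≤-trans (toℕ<n r) (ℕₚ.≤-trans (∣⇒≤ (gcd[m,n]∣m c k))
        (ℕₚ.+-cancelʳ-≤ k c n (subst (c + k ≤_) (sym (trans size (ℕₚ.*-suc c k)))
          (ℕₚ.+-monoʳ-≤ c (ℕₚ.m≤n*m k c)))))
      prefix-≡0 : ∀ {n} (v : Vector ℚ n) → (∀ j → v j ≡ 0ℚ) → ∀ m → prefix v m ≡ 0ℚ
      prefix-≡0 {zero}  v eq m       = refl
      prefix-≡0 {suc n} v eq zero    = refl
      prefix-≡0 {suc n} v eq (suc m) = cong₂ ℚ._+_ (eq zero) (prefix-≡0 (v ∘ suc) (eq ∘ suc) m)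

  -- From kernel vectors back to periodic heights

  module _ (v : Vector ℚ n) (v∈ker : InKernel (A n k) v) where
    private
      F Q h : ℕ → ℚ
      F = delayed k v
      Q m = F (m + suc k) ℚ.- F m
      -- The row conditions control `Q` only on a bounded range, so its first `k` values are
      -- extended periodically to all of ℕ.
      h m = Q (m % k)

      Q-periodic : ∀ {i} → i < n → Q (i + k) ≡ Q i
      Q-periodic {i} i<n = begin
        F (i + k + suc k) ℚ.- F (i + k)
          ≡⟨ solve 3 (λ p q r → p :- q := p :+ r :- q :- r) refl (F (i + k + suc k)) (F (i + k)) (F i) ⟩
        F (i + k + suc k) ℚ.+ F i ℚ.- F (i + k) ℚ.- F i
          ≡⟨ cong (λ y → y ℚ.- F (i + k) ℚ.- F i) row ⟨
        0ℚ ℚ.+ (F (i + suc k) ℚ.+ F (i + k)) ℚ.- F (i + k) ℚ.- F i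
          ≡⟨ solve 3 (λ p q r → con 0ℚ :+ (p :+ q) :- q :- r := p :- r) refl (F (i + suc k)) (F (i + k)) (F i) ⟩
        F (i + suc k) ℚ.- F i ∎
        where
        j = fromℕ< i<n
        row : 0ℚ ℚ.+ (F (i + suc k) ℚ.+ F (i + k)) ≡ F (i + k + suc k) ℚ.+ F i
        row = subst (λ x → 0ℚ ℚ.+ (F (x + suc k) ℚ.+ F (x + k)) ≡ F (x + k + suc k) ℚ.+ F x)
          (toℕ-fromℕ< i<n)
          (subst (λ y → y ℚ.+ (F (toℕ j + suc k) ℚ.+ F (toℕ j + k)) ≡ F (toℕ j + k + suc k) ℚ.+ F (toℕ j))
            (v∈ker j) (A-row-delayed k v j))

      stairs : IsStaircase k c F h
      stairs = record
        { low  = delayed-low k v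
        ; step = λ {m} m<N → begin
            F (m + suc k)     ≡⟨ solve 2 (λ p q → p := q :+ (p :- q)) refl (F (m + suc k)) (F m) ⟩
            F m ℚ.+ Q m       ≡⟨ cong (F m ℚ.+_) (partially-periodic-% n k Q Q-periodic
                                   (subst (m <_) (sym size) m<N)) ⟩
            F m ℚ.+ h m       ∎
        }

      k-periodic : Periodic k h
      k-periodic m = cong Q ([m+n]%n≡m%n m k)

      -- Converse of the constancy of row `c`: all of that row lies where the prefix sums are
      -- saturated, so the shift identity forces h(i) = h(i+c) for i < k. Reduction modulo `k`
      -- extends this to every position.
      c-periodic : Periodic c h
      c-periodic m = begin
        h (m + c)                     ≡⟨ cong (λ x → h (x + c)) (m≡m%n+[m/n]*n m k) ⟩
        h (i + (m / k) * k + c)       ≡⟨ cong h (trans (ℕₚ.+-assoc i _ c) (trans (cong (i +_) (ℕₚ.+-comm _ c)) (sym (ℕₚ.+-assoc i c _)))) ⟩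
        h (i + c + (m / k) * k)       ≡⟨ periodic-* k-periodic (m / k) (i + c) ⟩
        h (i + c)                     ≡⟨ +-cancelˡ (prefix v n) _ _ shift ⟨
        h i                           ≡⟨ periodic-% k-periodic m ⟩
        h m                           ∎
        where
        i = m % k
        shift : prefix v n ℚ.+ h i ≡ prefix v n ℚ.+ h (i + c)
        shift = begin
          prefix v n ℚ.+ h i
            ≡⟨ cong (ℚ._+ h i) (delayed-high k v (high (suc i))) ⟨
          F (suc i + c * suc k) ℚ.+ h i
            ≡⟨ staircase-shift stairs k-periodic (m%n<n m k) ℕₚ.≤-refl ⟩
          F (i + c * suc k) ℚ.+ h (i + c)
            ≡⟨ cong (ℚ._+ h (i + c)) (delayed-high k v (high i)) ⟩
          prefix v n ℚ.+ h (i + c) ∎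

    coordinates : Vector ℚ d
    coordinates r = h (toℕ r)

    -- The delayed prefix sums of `v` and the staircase over `coordinates` have the same climbs,
    -- hence coincide; differencing recovers `v`.
    kernelVector-coordinates : ∀ j → v j ≡ kernelVector n k coordinates j
    kernelVector-coordinates j = begin
      v j
        ≡⟨ solve 2 (λ p q → q := p :+ q :- p) refl (prefix v x) (v j) ⟩
      prefix v x ℚ.+ v j ℚ.- prefix v x
        ≡⟨ cong (ℚ._- prefix v x) (prefix-suc v j) ⟨
      prefix v (suc x) ℚ.- prefix v x
        ≡⟨ cong₂ ℚ._-_ (delayed-+ k v (suc x)) (delayed-+ k v x) ⟨
      F (suc x + k) ℚ.- F (x + k)
        ≡⟨ cong₂ ℚ._-_ (agree x<n) (agree (ℕₚ.<⇒≤ x<n)) ⟩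
      kernelVector n k coordinates j ∎
      where
      x = toℕ j
      x<n = toℕ<n j
      -- Periods `c` and `k` give period gcd(c,k), so the first gcd(c,k) heights determine all of
      -- them.
      h≗cycle : ∀ m → h m ≡ cycle coordinates m
      h≗cycle m = begin
        h m                ≡⟨ periodic-% (periodic-gcd c-periodic k-periodic) m ⟨
        h (m % d)          ≡⟨ cong h (toℕ-fromℕ< (m%n<n m d)) ⟨
        h (toℕ (m mod d))  ∎
      agree : ∀ {y} → y ≤ n → F (y + k) ≡ staircase k (cycle coordinates) (y + k)
      agree y≤n = staircase-unique stairs (staircase-isStaircase k c (cycle coordinates)) h≗cycle
        (<-range (ℕₚ.≤-trans (ℕₚ.+-monoˡ-≤ k y≤n) (ℕₚ.m≤m+n (n + k) k)))

  -- The basis is the image of the standard basis. By linearity, independence is injectivity of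
  -- `kernelVector` and spanning is its surjectivity onto the kernel.
  nullity : N[ n , k ]≡ gcd c k
  nullity = (λ r → kernelVector n k (unit r)) , record
    { inKernel    = λ r → kernelVector-inKernel (unit r)
    ; independent = λ a eq → kernelVector-injective a
        (λ j → trans (sym (kernelVector-linear n k a j)) (eq j))
    ; spanning    = λ v v∈ker → coordinates v v∈ker , λ j →
        trans (kernelVector-coordinates v v∈ker j)
          (sym (kernelVector-linear n k (coordinates v v∈ker) j))
    }

theorem8p8 : ∀ (k c : ℕ) → 1 < c → c < k → N[ c * k + c ∸ k , k ]≡ gcd c k
theorem8p8 k c 1<c c<k = nullity (c * k + c ∸ k) k c size
  where
  instance
    k≢0 : NonZero k
    k≢0 = >-nonZero (ℕₚ.≤-<-trans z≤n c<k)
    c≢0 : NonZero c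
    c≢0 = >-nonZero (ℕₚ.≤-<-trans z≤n 1<c)
  -- The truncated subtraction is exact because k ≤ ck.
  size : c * k + c ∸ k + k ≡ c * suc k
  size = begin
    c * k + c ∸ k + k ≡⟨ ℕₚ.m∸n+n≡m (ℕₚ.≤-trans (ℕₚ.m≤n*m k c) (ℕₚ.m≤m+n (c * k) c)) ⟩
    c * k + c         ≡⟨ ℕₚ.+-comm (c * k) c ⟩
    c + c * k         ≡⟨ ℕₚ.*-suc c k ⟨
    c * suc k         ∎
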